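{- There exist infinitely many pairwise distinct hereditary classes of graphs $X$ such that $X$ is both a minimal hereditary class of unbounded clique-width and a minimal hereditary class of unbounded linear clique-width.
   Context: Graphs are undirected, finite, nonempty, without loops or multiple edges. A class of graphs (closed under isomorphism) is hereditary if it is closed under taking induced subgraphs. The clique-width $\mathrm{cwd}(G)$ of a graph $G$ is the minimum number of labels needed to construct $G$ (as a labelled graph, labels then forgotten) by an expression using the following operations: creation of a new vertex $v$ with label $i$ (denoted $i(v)$); disjoint union $\oplus$ of two labelled graphs; $\eta_{i,j}$ ($i\neq j$), adding all edges between vertices labelled $i$ and vertices labelled $j$; $\rho_{i\to j}$, renaming label $i$ to label $j$. The linear clique-width $\mathrm{lcwd}(G)$ is the minimum number of labels in such an expression whose associated tree is a caterpillar, i.e. in which every $\oplus$-operation has at least one operand that is a single newly created vertex. A class has unbounded clique-width (respectively, linear clique-width) if there is no constant $c$ with $\mathrm{cwd}(G)\le c$ (respectively, $\mathrm{lcwd}(G)\le c$) for all $G$ in the class. A hereditary class $X$ is a minimal hereditary class of unbounded clique-width (respectively, linear clique-width) if $X$ has unbounded clique-width (respectively, linear clique-width) and every hereditary class properly contained in $X$ has bounded clique-width (respectively, linear clique-width). -}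

module Defs where

open import Data.Bool using (Bool; true; false; if_then_else_; _∧_; _∨_)
open import Data.Fin using (Fin; _≟_)
open import Data.Nat using (ℕ; NonZero; _≤_)
open import Data.Product using (_×_; ∃)
open import Data.Sum using (_⊎_; inj₁; inj₂; [_,_])
open import Data.Unit using (⊤)
open import Function.Bundles using (_↔_; Inverse)
open import Function.Definitions using (Injective)
open import Level using (0ℓ)
open import Relation.Binary.PropositionalEquality using (_≡_; _≢_)
open import Relation.Nullary using (¬_; does)
open import Relation.Unary using (Pred; _∈_; _⊆_; _≬_; ∁)

record Graph : Set where
  field
    order      : ℕ
    ⦃ nonempty ⦄ : NonZero order

  Vertex : Set
  Vertex = Fin order

  field
    adj    : Vertex → Vertex → Bool
    sym    : ∀ u v → adj u v ≡ adj v u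
    irrefl : ∀ v → adj v v ≡ false

open Graph using (Vertex)

-- H ≼ G: H is isomorphic to an induced subgraph of G.
_≼_ : Graph → Graph → Set
H ≼ G = ∃ λ (f : Vertex H → Vertex G) →
  Injective _≡_ _≡_ f × (∀ u v → Graph.adj H u v ≡ Graph.adj G (f u) (f v))

-- Closure under isomorphism is the case where the embedding is bijective.
Hereditary : Pred Graph 0ℓ → Set
Hereditary X = ∀ {G H} → H ≼ G → G ∈ X → H ∈ X

data Expr (k : ℕ) : Set where
  •   : (i : Fin k) → Expr k
  _⊕_ : (a b : Expr k) → Expr k
  η   : (i j : Fin k) → i ≢ j → Expr k → Expr k
  ρ   : (i j : Fin k) → Expr k → Expr k

-- The labelled graph denoted by an expression: its vertices are the
-- occurrences of • in the expression.

⟦_⟧ : ∀ {k} → Expr k → Set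
⟦ • i ⟧       = ⊤
⟦ a ⊕ b ⟧     = ⟦ a ⟧ ⊎ ⟦ b ⟧
⟦ η i j _ e ⟧ = ⟦ e ⟧
⟦ ρ i j e ⟧   = ⟦ e ⟧

label : ∀ {k} (e : Expr k) → ⟦ e ⟧ → Fin k
label (• i)       _ = i
label (a ⊕ b)       = [ label a , label b ]
label (η i j _ e) v = label e v
label (ρ i j e)   v = if does (label e v ≟ i) then j else label e v

edge : ∀ {k} (e : Expr k) → ⟦ e ⟧ → ⟦ e ⟧ → Bool
edge (• i)       _        _        = false
edge (a ⊕ b)     (inj₁ u) (inj₁ v) = edge a u v
edge (a ⊕ b)     (inj₁ u) (inj₂ v) = false
edge (a ⊕ b)     (inj₂ u) (inj₁ v) = false
edge (a ⊕ b)     (inj₂ u) (inj₂ v) = edge b u v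
edge (η i j _ e) u        v        = edge e u v
  ∨ (does (label e u ≟ i) ∧ does (label e v ≟ j))
  ∨ (does (label e u ≟ j) ∧ does (label e v ≟ i))
edge (ρ i j e)   u        v        = edge e u v

_Constructs_ : ∀ {k} → Expr k → Graph → Set
e Constructs G = ∃ λ (φ : Vertex G ↔ ⟦ e ⟧) →
  ∀ u v → Graph.adj G u v ≡ edge e (Inverse.to φ u) (Inverse.to φ v)

-- The tree of the expression is a caterpillar.
data Linear {k : ℕ} : Expr k → Set where
  •   : ∀ i → Linear (• i)
  _⊕• : ∀ {a i} → Linear a → Linear (a ⊕ • i)
  •⊕_ : ∀ {i b} → Linear b → Linear (• i ⊕ b)
  η   : ∀ {i j i≢j e} → Linear e → Linear (η i j i≢j e)
  ρ   : ∀ {i j e} → Linear e → Linear (ρ i j e)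

IsMinimum : Pred ℕ 0ℓ → ℕ → Set
IsMinimum P m = P m × (∀ k → P k → m ≤ k)

-- A graph parameter is given by its graph: p G w says that w is its value at G.
Parameter : Set₁
Parameter = Graph → Pred ℕ 0ℓ

cwd lcwd : Parameter
cwd  G = IsMinimum λ k → ∃ λ (e : Expr k) → e Constructs G
lcwd G = IsMinimum λ k → ∃ λ (e : Expr k) → Linear e × e Constructs G

-- "p(G) ≤ c" is read as: every value of p at G is ≤ c.  For cwd and lcwd the
-- value is unique, and exists up to double negation, since order G labels
-- suffice to construct G.
Bounded Unbounded : Parameter → Pred Graph 0ℓ → Set
Bounded   p X = ∃ λ c → ∀ G → G ∈ X → ∀ w → p G w → w ≤ c
Unbounded p X = ¬ Bounded p X

-- Proper containment is witnessed by a member of X outside Y; the library's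
-- Y ⊂ X only refutes X ⊆ Y, which is constructively weaker.
_⊊_ : Pred Graph 0ℓ → Pred Graph 0ℓ → Set
Y ⊊ X = Y ⊆ X × X ≬ ∁ Y

MinimalHereditaryUnbounded : Parameter → Pred Graph 0ℓ → Set₁
MinimalHereditaryUnbounded p X =
  Hereditary X × Unbounded p X × (∀ Y → Hereditary Y → Y ⊊ X → Bounded p Y)

{-# OPTIONS --safe #-}
-- For p ≥ 1 let X be the class of induced subgraphs of the graph on ℕ × ℕ whose rows are paths and
-- whose columns 0, p, 2p, … are cliques.
--
-- X is unbounded: in an expression for a large grid with k labels, vertices of a subexpression that
-- share a label have the same neighbours outside it.  The first union that meets many rows still
-- misses one.  If it contains a full row, more than k clique columns meet that row and the missed
-- one, and two of them get the same label; otherwise each of the many rows is left along an edge,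
-- and two rows agree on the columns and the label of that edge.
--
-- A subclass missing some H ∈ X is bounded: cut the columns into windows of a width K, a multiple of
-- p exceeding the width of H.  In each window fewer than N rows are full, since otherwise H embeds.
-- Cut every row at its first gap in each window, and build the graph piece by piece from left to
-- right.  At any moment the edges to the remaining vertices are determined by boundedly many data:
-- position relative to the current window, rank among the full rows, membership of the current row.
--
-- Different p give different classes: the triangles at columns 0 and p are joined by a path of length
-- p, and for q > p the clique columns of the graph for q are too far apart.

module Submission where

open import Defs
open import Data.Bool using (Bool; true; false; if_then_else_; _∧_; _∨_)
import Data.Bool.Properties as Bool
open import Data.Empty using (⊥; ⊥-elim)
open import Data.Fin using (Fin; zero; suc; _≟_; _↑ˡ_; _↑ʳ_; combine; splitAt; toℕ; fromℕ<; remQuot)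
open import Data.Fin.Properties using (any?; all?; pigeonhole; combine-injective; <⇒≢; <⇒notInjective; combine-remQuot; remQuot-combine; toℕ-injective; toℕ<n; toℕ-fromℕ<; fromℕ<-injective; ¬∀⟶∃¬; ↑ˡ-injective; ↑ʳ-injective; splitAt-↑ˡ; splitAt-↑ʳ; suc-injective)
open import Data.List using (List; []; _∷_; allFin)
open import Data.Bool.ListAction using (any)
open import Data.List.Membership.Propositional using () renaming (_∈_ to _∈ₗ_)
open import Data.List.Membership.Propositional.Properties using (∈-allFin)
open import Data.List.Relation.Unary.Any using (here; there)
open import Data.Nat as ℕ using (ℕ; zero; suc; _+_; _*_; _≤_; _<_; s≤s; NonZero; _<?_; _⊔_; _⊓_; _∸_)
import Data.Nat.Properties as ℕ
open import Data.Nat.DivMod using (_/_; _%_; m≡m%n+[m/n]*n; [m+kn]%n≡m%n; m%n<n; m<n⇒m%n≡m; m<n⇒m/n≡0; m*n/n≡m; +-distrib-/-∣ʳ)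
open import Data.Nat.Divisibility using (_∣_; _∣?_; divides-refl; ∣m∣n⇒∣m+n; ∣m+n∣m⇒∣n; _∣0; ∣-refl; ∣-trans; n∣m*n; m∣m*n; ∣⇒≤)
open import Data.Nat.Induction using (<-rec)
open import Data.Product using (_×_; ∃; _,_; proj₁; proj₂; curry)
open import Data.Product.Properties using (≡-dec)
import Data.Sum as Sum
open import Data.Sum using (_⊎_; inj₁; inj₂; [_,_])
open import Data.Unit using (tt)
open import Function.Base using (_∘_; id)
open import Function.Bundles using (_⇔_; mk⇔; Inverse; mk↔ₛ′)
open import Function.Definitions using (Injective)
open import Level using (0ℓ)
open import Relation.Binary.Definitions using (tri<; tri≈; tri>)
open import Relation.Binary.PropositionalEquality using (_≡_; _≢_; refl; sym; trans; cong; cong₂; subst; subst₂; module ≡-Reasoning)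
open import Relation.Nullary using (¬_; Dec; yes; no; does; contradiction)
open import Relation.Nullary.Decidable using (does-⇔; dec-true; dec-false; decidable-stable; map′; _×-dec_; _⊎-dec_; ¬?)
open import Relation.Unary using (Pred; _⊆_; _≐_)

open Graph using (Vertex)

-- Linear expressions realising labelled vertex sets

-- `E` may be any relation, so that the intermediate graphs met while a vertex is being attached can
-- be described too. `V` stays fixed while `S` grows, which avoids composing bijections.
record Realises {V : Set} {m} (S : Pred V 0ℓ) (L : V → Fin m) (E : V → V → Bool) : Set where
  field
    expr      : Expr m
    linear    : Linear expr
    vertex    : ⟦ expr ⟧ → V
    injective : Injective _≡_ _≡_ vertex
    sound     : ∀ a → S (vertex a)
    complete  : ∀ {v} → S v → ∃ λ a → vertex a ≡ v
    labels    : ∀ a → label expr a ≡ L (vertex a)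
    edges     : ∀ a b → edge expr a b ≡ E (vertex a) (vertex b)

module _ {V : Set} {m : ℕ} where

  private variable
    S S′ : Pred V 0ℓ
    L L′ : V → Fin m
    E E′ : V → V → Bool

  resp : (∀ {v} → S v → L v ≡ L′ v) → (∀ {u v} → S u → S v → E u v ≡ E′ u v) →
         Realises S L E → Realises S L′ E′
  resp L≡ E≡ R = record
    { Realises R
    ; labels = λ a → trans (labels a) (L≡ (sound a))
    ; edges  = λ a b → trans (edges a b) (E≡ (sound a) (sound b))
    } where open Realises R

  single : ∀ {x} → S x → (∀ {v} → S v → v ≡ x) → E x x ≡ false → Realises S L E
  single {L = L} {x = x} Sx only Exx = record
    { expr = • (L x) ; linear = • (L x) ; vertex = λ _ → x ; injective = λ _ → refl
    ; sound = λ _ → Sx ; complete = λ Sv → tt , sym (only Sv)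
    ; labels = λ _ → refl ; edges = λ _ _ → sym Exx }

  extend : ∀ x → ¬ S x → (∀ {v} → S v → S′ v) → S′ x → (∀ {v} → S′ v → S v ⊎ v ≡ x) →
           (∀ {v} → E v x ≡ false) → (∀ {v} → E x v ≡ false) →
           Realises S L E → Realises S′ L E
  extend {S = S} {S′ = S′} {E = E} {L = L} x ¬Sx S⊆S′ S′x split Evx Exv R = record
    { expr = expr ⊕ • (L x)
    ; linear = linear ⊕•
    ; vertex = vertex′
    ; injective = inj
    ; sound = λ { (inj₁ a) → S⊆S′ (sound a) ; (inj₂ _) → S′x }
    ; complete = λ S′v → comp (split S′v)
    ; labels = λ { (inj₁ a) → labels a ; (inj₂ _) → refl }
    ; edges = λ { (inj₁ a) (inj₁ b) → edges a b ; (inj₁ a) (inj₂ b) → sym Evx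
                ; (inj₂ a) (inj₁ b) → sym Exv ; (inj₂ a) (inj₂ b) → sym Exv }
    }
    where
    open Realises R
    vertex′ : ⟦ expr ⊕ • (L x) ⟧ → V
    vertex′ = [ vertex , (λ _ → x) ]
    inj : Injective _≡_ _≡_ vertex′
    inj {inj₁ a} {inj₁ b} eq = cong inj₁ (injective eq)
    inj {inj₁ a} {inj₂ b} eq = contradiction (subst S eq (sound a)) ¬Sx
    inj {inj₂ a} {inj₁ b} eq = contradiction (subst S (sym eq) (sound b)) ¬Sx
    inj {inj₂ a} {inj₂ b} eq = refl
    comp : ∀ {v} → S v ⊎ v ≡ x → ∃ λ a → vertex′ a ≡ v
    comp (inj₁ Sv) = let a , eq = complete Sv in inj₁ a , eq
    comp (inj₂ eq) = inj₂ tt , sym eq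

  rename : ∀ i j → Realises S L E → Realises S (λ v → if does (L v ≟ i) then j else L v) E
  rename i j R = record
    { Realises R
    ; expr = ρ i j expr
    ; linear = ρ linear
    ; labels = λ a → cong (λ l → if does (l ≟ i) then j else l) (labels a)
    } where open Realises R

  join : ∀ i j → i ≢ j → Realises S L E → Realises S L (λ u v → E u v
    ∨ (does (L u ≟ i) ∧ does (L v ≟ j))
    ∨ (does (L u ≟ j) ∧ does (L v ≟ i)))
  join i j i≢j R = record
    { Realises R
    ; expr = η i j i≢j expr
    ; linear = η linear
    ; edges = λ a b → cong₂ _∨_ (edges a b) (cong₂ (λ l l′ → (does (l ≟ i) ∧ does (l′ ≟ j))
                    ∨ (does (l ≟ j) ∧ does (l′ ≟ i))) (labels a) (labels b))
    } where open Realises R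

-- Simultaneous relabelling, and joining one label to many

does-injective : ∀ {m n} {f : Fin m → Fin n} → Injective _≡_ _≡_ f → ∀ i j → does (f i ≟ f j) ≡ does (i ≟ j)
does-injective {f = f} inj i j = does-⇔ (mk⇔ inj (cong f)) (f i ≟ f j) (i ≟ j)

module _ {K M : ℕ} {src dst : Fin K → Fin M}
         (src-inj : Injective _≡_ _≡_ src) (disjoint : ∀ i j → dst i ≢ src j) where

  move : List (Fin K) → Fin M → Fin M
  move []       l = l
  move (i ∷ is) l = move is (if does (l ≟ src i) then dst i else l)

  move-dst : ∀ is j → move is (dst j) ≡ dst j
  move-dst []       j = refl
  move-dst (i ∷ is) j rewrite dec-false (dst j ≟ src i) (disjoint j i) = move-dst is j

  move-src : ∀ {is j} → j ∈ₗ is → move is (src j) ≡ dst j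
  move-src {i ∷ is} {j} j∈ with src j ≟ src i
  ... | yes eq rewrite src-inj eq = move-dst is i
  move-src {i ∷ is} {j} (here refl)  | no neq = contradiction refl neq
  move-src {i ∷ is} {j} (there j∈) | no neq = move-src j∈

  renames : ∀ {V : Set} {S : Pred V 0ℓ} {L : V → Fin M} {E} is → Realises S L E → Realises S (move is ∘ L) E
  renames []       R = R
  renames (i ∷ is) R = renames is (rename (src i) (dst i) R)

  -- `ρ` acts on one label at a time. As no target is a source, a label once moved is never moved
  -- again, so the successive renamings act simultaneously, even where `dst` merges labels.
  relabel : ∀ {V : Set} {S : Pred V 0ℓ} {E} (L : V → Fin K) → Realises S (src ∘ L) E → Realises S (dst ∘ L) E
  relabel L R = resp (λ {v} _ → move-src (∈-allFin (L v))) (λ _ _ → refl) (renames (allFin K) R)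

module _ {k : ℕ} (h : Fin k → Bool) where

  -- The edges present once label `zero` has been joined to the selected labels of a partial list;
  -- with the list as an argument, `joins` can add one `η` at a time.
  star : List (Fin k) → Fin (suc k) → Fin (suc k) → Bool
  star is zero    (suc j) = h j ∧ any (λ i → does (j ≟ i)) is
  star is (suc j) zero    = h j ∧ any (λ i → does (j ≟ i)) is
  star is zero    zero    = false
  star is (suc _) (suc _) = false

  star-[] : ∀ a b → star [] a b ≡ false
  star-[] zero    zero    = refl
  star-[] zero    (suc j) = Bool.∧-zeroʳ (h j)
  star-[] (suc j) zero    = Bool.∧-zeroʳ (h j)
  star-[] (suc _) (suc _) = refl

  star-∷-true : ∀ {i} is → h i ≡ true → ∀ a b → star (i ∷ is) a b ≡ star is a b ∨
    (does (a ≟ zero) ∧ does (b ≟ suc i)) ∨ (does (a ≟ suc i) ∧ does (b ≟ zero))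
  star-∷-true is hi zero zero = refl
  star-∷-true {i} is hi zero (suc j) with j ≟ i
  ... | yes refl rewrite hi = sym (Bool.∨-zeroʳ _)
  ... | no  _    = sym (Bool.∨-identityʳ _)
  star-∷-true {i} is hi (suc j) zero with j ≟ i
  ... | yes refl rewrite hi = sym (Bool.∨-zeroʳ _)
  ... | no  _    = sym (Bool.∨-identityʳ _)
  star-∷-true {i} is hi (suc j) (suc j′) = sym (Bool.∧-zeroʳ _)

  star-∷-false : ∀ {i} is → h i ≡ false → ∀ a b → star (i ∷ is) a b ≡ star is a b
  star-∷-false is hi zero zero = refl
  star-∷-false {i} is hi zero (suc j) with j ≟ i
  ... | yes refl rewrite hi = refl
  ... | no  _    = refl
  star-∷-false {i} is hi (suc j) zero with j ≟ i
  ... | yes refl rewrite hi = refl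
  ... | no  _    = refl
  star-∷-false is hi (suc _) (suc _) = refl

  joins : ∀ {V : Set} {S : Pred V 0ℓ} {M} {bank : Fin (suc k) → Fin M} → Injective _≡_ _≡_ bank →
          ∀ (L : V → Fin (suc k)) {E} is → Realises S (bank ∘ L) E →
          Realises S (bank ∘ L) (λ u v → E u v ∨ star is (L u) (L v))
  joins {bank = bank} bank-inj L {E} [] R = resp (λ _ → refl)
    (λ {u} {v} _ _ → sym (trans (cong (E u v ∨_) (star-[] (L u) (L v))) (Bool.∨-identityʳ _))) R
  joins {bank = bank} bank-inj L {E} (i ∷ is) R with h i in hi
  ... | false = resp (λ _ → refl)
    (λ {u} {v} _ _ → cong (E u v ∨_) (sym (star-∷-false is hi (L u) (L v)))) (joins bank-inj L is R)
  ... | true  = resp (λ _ → refl)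
    (λ {u} {v} _ _ → trans
      (cong ((E u v ∨ star is (L u) (L v)) ∨_) (cong₂ _∨_
        (cong₂ _∧_ (does-injective bank-inj (L u) zero) (does-injective bank-inj (L v) (suc i)))
        (cong₂ _∧_ (does-injective bank-inj (L u) (suc i)) (does-injective bank-inj (L v) zero))))
      (trans (Bool.∨-assoc (E u v) _ _) (cong (E u v ∨_) (sym (star-∷-true is hi (L u) (L v))))))
    (join (bank zero) (bank (suc i)) (λ eq → contradiction (bank-inj eq) λ ()) (joins bank-inj L is R))

any-allFin : ∀ {k} (j : Fin k) → any (λ i → does (j ≟ i)) (allFin _) ≡ true
any-allFin {k} j = go (∈-allFin j)
  where
  go : ∀ {is : List (Fin k)} → j ∈ₗ is → any (λ i → does (j ≟ i)) is ≡ true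
  go (here refl) rewrite dec-true (j ≟ j) refl = refl
  go {i ∷ is} (there j∈) rewrite go j∈ = Bool.∨-zeroʳ (does (j ≟ i))

-- Building a graph by sweeping through its vertices

bounded : ∀ {n} (f : Fin n → ℕ) → ∃ λ b → ∀ i → f i < b
bounded {zero}  f = 0 , λ ()
bounded {suc n} f = let b , lt = bounded (f ∘ suc) in suc (f zero) ⊔ b ,
  λ { zero → ℕ.m≤m⊔n _ b ; (suc i) → ℕ.≤-trans (lt i) (ℕ.m≤n⊔m _ _) }

↑ˡ≢↑ʳ : ∀ {m n} {i : Fin m} {j : Fin n} → i ↑ˡ n ≢ m ↑ʳ j
↑ˡ≢↑ʳ {m} {n} {i} {j} eq with trans (sym (splitAt-↑ˡ m i n)) (trans (cong (splitAt m) eq) (splitAt-↑ʳ m n j))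
... | ()

ConstructsLinearly : ℕ → Graph → Set
ConstructsLinearly k G = ∃ λ (e : Expr k) → Linear e × e Constructs G

-- Vertices are created in increasing order of `key`. Since equal classes mean equal adjacency to
-- everything still to come, the next vertex can be joined to whole classes, and the number of
-- labels depends on `k` alone.
module Sweep (G : Graph) {k : ℕ} (key : Vertex G → ℕ) (key-inj : Injective _≡_ _≡_ key)
  (class : Vertex G → Vertex G → Fin k)
  (class-adj : ∀ x {u v} → key u ≤ key x → key v ≤ key x → class x u ≡ class x v →
               ∀ y → key x < key y → Graph.adj G u y ≡ Graph.adj G v y)
  where

  open Graph G using (adj; irrefl; nonempty) renaming (sym to adj-sym)

  Below : ℕ → Pred (Vertex G) 0ℓ
  Below t v = key v < t

  bankˡ bankʳ : Fin (suc k) → Fin (suc k + suc k)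
  bankˡ i = i ↑ˡ suc k
  bankʳ i = suc k ↑ʳ i

  bankˡ-injective : Injective _≡_ _≡_ bankˡ
  bankˡ-injective = ↑ˡ-injective (suc k) _ _

  bankʳ-injective : Injective _≡_ _≡_ bankʳ
  bankʳ-injective = ↑ʳ-injective (suc k) _ _

  -- Label zero is reserved for the vertex being added.  Labels rest in the left bank; recolouring
  -- goes through the right bank because ρ renames one label at a time.
  record Prefix (t : ℕ) : Set where
    field
      colour     : Vertex G → Fin k
      colour-adj : ∀ {u v} → Below t u → Below t v → colour u ≡ colour v →
                   ∀ {y} → t ≤ key y → adj u y ≡ adj v y
      realises   : Realises (Below t) (bankˡ ∘ suc ∘ colour) adj

  module Step (x : Vertex G) where

    t = key x

    -- Renaming treats all vertices with one mark alike, so a vertex takes the class of a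
    -- representative `u*` instead of its own. This is harmless because `u` and `u*` agree on all
    -- later vertices.
    finish : (mark : Vertex G → Fin (suc k)) (recolour : Fin (suc k) → Fin k) →
             (∀ {u} → Below (suc t) u → ∃ λ u* → key u* ≤ t × recolour (mark u) ≡ class x u* ×
               (∀ {y} → suc t ≤ key y → adj u y ≡ adj u* y)) →
             Realises (Below (suc t)) (bankˡ ∘ mark) adj → Prefix (suc t)
    finish mark recolour rep R = record
      { colour = recolour ∘ mark
      ; colour-adj = λ u< v< eq y> →
          let u* , u*≤ , u≡ , u~ = rep u< ; v* , v*≤ , v≡ , v~ = rep v< in
          trans (u~ y>) (trans (class-adj x u*≤ v*≤ (trans (sym u≡) (trans eq v≡)) _ y>) (sym (v~ y>)))
      ; realises = relabel {dst = bankˡ} bankʳ-injective (λ _ _ → ↑ˡ≢↑ʳ {m = suc k}) (suc ∘ recolour ∘ mark)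
          (relabel {dst = bankʳ ∘ suc ∘ recolour} bankˡ-injective (λ _ _ → ↑ˡ≢↑ʳ {n = suc k} ∘ sym) mark R)
      }

    below⁻ : ∀ {v} → Below (suc t) v → Below t v ⊎ v ≡ x
    below⁻ (s≤s v≤) with ℕ.m≤n⇒m<n∨m≡n v≤
    ... | inj₁ v< = inj₁ v<
    ... | inj₂ v≡ = inj₂ (key-inj v≡)

    first : (∀ v → t ≤ key v) → Prefix (suc t)
    first least = finish (λ _ → zero) (λ _ → class x x)
      (λ u< → x , ℕ.≤-refl , refl , λ _ → cong (λ u → adj u _) (only u<))
      (single (ℕ.n<1+n t) only (irrefl x))
      where
      only : ∀ {v} → Below (suc t) v → v ≡ x
      only v< = [ (λ v<t → contradiction v<t (ℕ.≤⇒≯ (least _))) , id ] (below⁻ v<)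

    next : Prefix t → Prefix (suc t)
    next P = finish mark recolour rep (resp (λ _ → refl) edges-ok (joins nbr bankˡ-injective mark (allFin k) added))
      where
      open Prefix P

      mark : Vertex G → Fin (suc k)
      mark v = if does (v ≟ x) then zero else suc (colour v)

      mark-x : mark x ≡ zero
      mark-x rewrite dec-true (x ≟ x) refl = refl

      mark-old : ∀ {v} → Below t v → mark v ≡ suc (colour v)
      mark-old {v} v< with v ≟ x
      ... | yes refl = contradiction v< (ℕ.<-irrefl refl)
      ... | no _     = refl

      Old : Fin k → Pred (Vertex G) 0ℓ
      Old i v = Below t v × colour v ≡ i

      old? : ∀ i → Dec (∃ (Old i))
      old? i = any? λ v → (key v <? t) ×-dec (colour v ≟ i)

      nbr : Fin k → Bool
      nbr i with old? i
      ... | yes (v , _) = adj v x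
      ... | no  _       = false

      nbr-colour : ∀ {v} → Below t v → nbr (colour v) ≡ adj v x
      nbr-colour {v} v< with old? (colour v)
      ... | yes (u , u< , eq) = colour-adj u< v< eq ℕ.≤-refl
      ... | no  none          = contradiction (v , v< , refl) none

      recolour : Fin (suc k) → Fin k
      recolour zero = class x x
      recolour (suc i) with old? i
      ... | yes (v , _) = class x v
      -- No earlier vertex has this colour, but some value is needed, and `Fin k` has no canonical
      -- element for general `k`.
      ... | no  _       = class x x

      rep : ∀ {u} → Below (suc t) u → ∃ λ u* → key u* ≤ t × recolour (mark u) ≡ class x u* ×
            (∀ {y} → suc t ≤ key y → adj u y ≡ adj u* y)
      rep {u} u< with below⁻ u<
      ... | inj₂ refl rewrite mark-x = x , ℕ.≤-refl , refl , λ _ → refl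
      ... | inj₁ u<t rewrite mark-old u<t with old? (colour u)
      ...   | yes (v , v< , eq) = v , ℕ.<⇒≤ v< , refl , λ y> → colour-adj u<t v< (sym eq) (ℕ.<⇒≤ y>)
      ...   | no  none          = contradiction (u , u<t , refl) none

      -- The graph just after the creation of `x`; `joins` then adds the edges at `x`.
      isolated : Vertex G → Vertex G → Bool
      isolated u v = if does (u ≟ x) then false else if does (v ≟ x) then false else adj u v

      isolatedˡ : ∀ {v} → isolated x v ≡ false
      isolatedˡ rewrite dec-true (x ≟ x) refl = refl

      isolatedʳ : ∀ {v} → isolated v x ≡ false
      isolatedʳ {v} rewrite dec-true (x ≟ x) refl with v ≟ x
      ... | yes _ = refl
      ... | no _  = refl

      isolated-old : ∀ {u v} → Below t u → Below t v → isolated u v ≡ adj u v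
      isolated-old {u} {v} u< v< with u ≟ x | v ≟ x
      ... | yes refl | _        = contradiction u< (ℕ.<-irrefl refl)
      ... | no _     | yes refl = contradiction v< (ℕ.<-irrefl refl)
      ... | no _     | no _     = refl

      added : Realises (Below (suc t)) (bankˡ ∘ mark) isolated
      added = extend x (ℕ.<-irrefl refl) ℕ.m<n⇒m<1+n (ℕ.n<1+n t) below⁻ (λ {v} → isolatedʳ {v}) isolatedˡ
        (resp (λ v< → cong bankˡ (sym (mark-old v<))) (λ u< v< → sym (isolated-old u< v<)) realises)

      star-nbr : ∀ {v} → Below t v → nbr (colour v) ∧ any (λ i → does (colour v ≟ i)) (allFin k) ≡ adj v x
      star-nbr {v} v< = trans (cong₂ _∧_ (nbr-colour v<) (any-allFin (colour v)))
                              (Bool.∧-identityʳ _)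

      edges-ok : ∀ {u v} → Below (suc t) u → Below (suc t) v →
        isolated u v ∨ star nbr (allFin k) (mark u) (mark v) ≡ adj u v
      edges-ok {u} {v} u< v< with below⁻ u< | below⁻ v<
      ... | inj₁ u<t  | inj₁ v<t rewrite mark-old u<t | mark-old v<t =
        trans (Bool.∨-identityʳ _) (isolated-old u<t v<t)
      ... | inj₁ u<t  | inj₂ refl rewrite mark-old u<t | mark-x | isolatedʳ {u} = star-nbr u<t
      ... | inj₂ refl | inj₁ v<t rewrite mark-old v<t | mark-x | isolatedˡ {v} = trans (star-nbr v<t) (adj-sym v x)
      ... | inj₂ refl | inj₂ refl rewrite mark-x | isolatedˡ {x} = sym (irrefl x)

  -- No expression denotes the empty graph, hence the second alternative for as long as no vertex
  -- lies below `t`. Keys may leave gaps; at a gap the prefix is carried over.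
  prefix : ∀ t → Prefix t ⊎ (∀ v → t ≤ key v)
  prefix zero = inj₂ λ _ → ℕ.z≤n
  prefix (suc t) with any? (λ v → key v ℕ.≟ t) | prefix t
  ... | yes (x , refl) | inj₁ P     = inj₁ (Step.next x P)
  ... | yes (x , refl) | inj₂ least = inj₁ (Step.first x least)
  ... | no none | inj₂ least = inj₂ λ v → ℕ.≤∧≢⇒< (least v) λ eq → none (v , sym eq)
  ... | no none | inj₁ P     = inj₁ record
    { colour = colour
    ; colour-adj = λ u< v< eq y≥ → colour-adj (below u<) (below v<) eq (ℕ.<⇒≤ y≥)
    ; realises = record { Realises realises ; sound = λ a → ℕ.m<n⇒m<1+n (sound a) ; complete = complete ∘ below }
    }
    where
    open Prefix P
    open Realises realises
    below : ∀ {v} → Below (suc t) v → Below t v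
    below (s≤s v≤) = ℕ.≤∧≢⇒< v≤ λ eq → none (_ , eq)

  constructs : ConstructsLinearly (suc k + suc k) G
  constructs with bounded key
  ... | t , key<t with prefix t
  -- `t` exceeds every key, so this alternative would leave `G` without vertices.
  ...   | inj₂ least = contradiction (key<t v₀) (ℕ.≤⇒≯ (least v₀))
    where
    point : ∀ {n} → ⦃ NonZero n ⦄ → Fin n
    point {suc _} = zero
    v₀ : Vertex G
    v₀ = point
  ...   | inj₁ P = expr , linear ,
    mk↔ₛ′ (λ v → proj₁ (complete (key<t v))) vertex
      (λ a → injective (proj₂ (complete (key<t (vertex a))))) (λ v → proj₂ (complete (key<t v))) ,
    λ u v → sym (trans (edges _ _) (cong₂ adj (proj₂ (complete (key<t u))) (proj₂ (complete (key<t v)))))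
    where
    open Prefix P
    open Realises realises

-- Counting, discrete boundaries, and search in expressions

-- "At most `N`" is expressed by a numbering injective on `P`, because the numbers themselves serve
-- as labels or as pigeonholes later.
few-or-many : ∀ {n} {P : Fin n → Set} → (∀ i → Dec (P i)) → ∀ N →
  (∃ λ (f : Fin N → Fin n) → Injective _≡_ _≡_ f × ∀ i → P (f i)) ⊎
  (∃ λ (g : Fin n → Fin N) → ∀ {i j} → P i → P j → g i ≡ g j → i ≡ j)
few-or-many P? zero = inj₁ ((λ ()) , (λ { {()} }) , λ ())
few-or-many {zero} P? (suc N) = inj₂ ((λ ()) , λ { {()} })
few-or-many {suc n} {P} P? (suc N) with P? zero
... | no ¬P0 with few-or-many (P? ∘ suc) (suc N)
...   | inj₁ (f , f-inj , Pf) = inj₁ (suc ∘ f , (λ eq → f-inj (suc-injective eq)) , Pf)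
...   | inj₂ (g , g-inj) = inj₂ (g′ , g′-inj)
  where
  g′ : Fin (suc n) → Fin (suc N)
  g′ zero    = zero
  g′ (suc i) = g i
  g′-inj : ∀ {i j} → P i → P j → g′ i ≡ g′ j → i ≡ j
  g′-inj {zero}  {_}     P0 _  _  = contradiction P0 ¬P0
  g′-inj {suc i} {zero}  _  P0 _  = contradiction P0 ¬P0
  g′-inj {suc i} {suc j} Pi Pj eq = cong suc (g-inj Pi Pj eq)
few-or-many {suc n} {P} P? (suc N) | yes P0 with few-or-many (P? ∘ suc) N
...   | inj₁ (f , f-inj , Pf) = inj₁ (f′ , f′-inj , λ { zero → P0 ; (suc i) → Pf i })
  where
  f′ : Fin (suc N) → Fin (suc n)
  f′ zero    = zero
  f′ (suc i) = suc (f i)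
  f′-inj : Injective _≡_ _≡_ f′
  f′-inj {zero}  {zero}  _  = refl
  f′-inj {suc i} {suc j} eq = cong suc (f-inj (suc-injective eq))
...   | inj₂ (g , g-inj) = inj₂ (g′ , g′-inj)
  where
  g′ : Fin (suc n) → Fin (suc N)
  g′ zero    = zero
  g′ (suc i) = suc (g i)
  g′-inj : ∀ {i j} → P i → P j → g′ i ≡ g′ j → i ≡ j
  g′-inj {zero}  {zero}  _  _  _  = refl
  g′-inj {suc i} {suc j} Pi Pj eq = cong suc (g-inj Pi Pj (suc-injective eq))

Consecutive : ∀ {n} → Fin n → Fin n → Set
Consecutive i j = suc (toℕ i) ≡ toℕ j ⊎ suc (toℕ j) ≡ toℕ i

-- A discrete intermediate value argument: if indices 0 and 1 agree, index 1 replaces the witness on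
-- its side and the search moves one step right.
boundary : ∀ {n} {P : Fin (suc n) → Set} → (∀ i → Dec (P i)) → ∃ P → ∃ (λ i → ¬ P i) →
           ∃ λ i → ∃ λ j → Consecutive i j × P i × ¬ P j
boundary {zero} P? (zero , P0) (zero , ¬P0) = contradiction P0 ¬P0
boundary {suc n} P? (i , Pi) (j , ¬Pj) with P? zero | P? (suc zero)
... | yes P0 | no ¬P1 = zero , suc zero , inj₁ refl , P0 , ¬P1
... | no ¬P0 | yes P1 = suc zero , zero , inj₂ refl , P1 , ¬P0
boundary {suc n} P? (i , Pi) (zero  , ¬P0) | yes P0 | yes P1 = contradiction P0 ¬P0
boundary {suc n} P? (i , Pi) (suc j , ¬Pj) | yes P0 | yes P1 with boundary {n} (P? ∘ suc) (zero , P1) (j , ¬Pj)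
... | i , j , near , Pi , ¬Pj = suc i , suc j , Sum.map (cong suc) (cong suc) near , Pi , ¬Pj
boundary {suc n} P? (zero  , P0) (j , ¬Pj) | no ¬P0 | no ¬P1 = contradiction P0 ¬P0
boundary {suc n} P? (suc i , Pi) (j , ¬Pj) | no ¬P0 | no ¬P1 with boundary {n} (P? ∘ suc) (i , Pi) (zero , ¬P1)
... | i , j , near , Pi , ¬Pj = suc i , suc j , Sum.map (cong suc) (cong suc) near , Pi , ¬Pj

search : ∀ {k} (e : Expr k) {P : ⟦ e ⟧ → Set} → (∀ a → Dec (P a)) → Dec (∃ P)
search (• i)       P? = map′ (tt ,_) proj₂ (P? tt)
search (a ⊕ b)     P? = map′ [ (λ (u , p) → inj₁ u , p) , (λ (u , p) → inj₂ u , p) ]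
  (λ { (inj₁ u , p) → inj₁ (u , p) ; (inj₂ u , p) → inj₂ (u , p) })
  (search a (P? ∘ inj₁) ⊎-dec search b (P? ∘ inj₂))
search (η i j _ e) P? = search e P?
search (ρ i j e)   P? = search e P?

-- Lower bound: large grids need many labels

module Grid {m b : ℕ} where

  -- `q` exceeds the number of triples of two columns and one of `b` labels, which forces a
  -- repetition among `q` mixed rows. `R` exceeds `q + q`, so two operands touching at most `q` rows
  -- each leave a row untouched.
  M q R : ℕ
  M = suc m
  q = suc (M * (M * b))
  R = suc (q + q)

  Position : Set
  Position = Fin M × Fin R

  module LowerBound {k : ℕ} (k≤b : k ≤ b) (adj : Position → Position → Bool)
    (row-adj : ∀ {c c′ r} → Consecutive c c′ → adj (c , r) (c′ , r) ≡ true)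
    (row-nonadj : ∀ {c c′ r r′} → Consecutive c c′ → r ≢ r′ → adj (c , r) (c′ , r′) ≡ false)
    (spine : Fin (suc b) → Fin M)
    (spine-adj : ∀ i {r r′} → r ≢ r′ → adj (spine i , r) (spine i , r′) ≡ true)
    (spine-nonadj : ∀ {i j} r r′ → i ≢ j → r ≢ r′ → adj (spine i , r) (spine j , r′) ≡ false)
    where

    Outside : (e : Expr k) → (⟦ e ⟧ → Position) → Position → Set
    Outside e ψ y = ∀ u → ψ u ≢ y

    -- Here `e` is a subexpression of an expression for the grid. The operations above it see its
    -- vertices only through their labels: `future` collects the edges they will add inside `e`, and
    -- `outside` says that they cannot separate equal labels.
    record Stage (e : Expr k) (ψ : ⟦ e ⟧ → Position) : Set where
      field
        future : Fin k → Fin k → Bool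
        inside : ∀ u v → adj (ψ u) (ψ v) ≡ edge e u v ∨ future (label e u) (label e v)
        outside : ∀ {u v} → label e u ≡ label e v → ∀ {y} → Outside e ψ y → adj (ψ u) y ≡ adj (ψ v) y

    hit? : (e : Expr k) (ψ : ⟦ e ⟧ → Position) (y : Position) → Dec (∃ λ u → ψ u ≡ y)
    hit? e ψ y = search e λ u → ≡-dec _≟_ _≟_ (ψ u) y

    stage-η : ∀ {i j i≢j e ψ} → Stage (η i j i≢j e) ψ → Stage e ψ
    stage-η {i} {j} {e = e} s = record
      { future = λ a b → ((does (a ≟ i) ∧ does (b ≟ j)) ∨ (does (a ≟ j) ∧ does (b ≟ i))) ∨ future a b
      ; inside = λ u v → trans (inside u v) (Bool.∨-assoc (edge e u v) _ _)
      ; outside = outside }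
      where open Stage s

    stage-ρ : ∀ {i j e ψ} → Stage (ρ i j e) ψ → Stage e ψ
    stage-ρ {i} {j} s = record
      { future = λ a b → future (if does (a ≟ i) then j else a) (if does (b ≟ i) then j else b)
      ; inside = inside
      ; outside = λ eq → outside (cong (λ a → if does (a ≟ i) then j else a) eq) }
      where open Stage s

    -- A cell outside `a` is either in `b`, and then all its edges to `a` come from above the union
    -- and depend on labels only, or outside the whole union.
    stage-⊕ˡ : ∀ {a b ψ} → Stage (a ⊕ b) ψ → Stage a (ψ ∘ inj₁)
    stage-⊕ˡ {a} {b} {ψ} s = record
      { future = future
      ; inside = λ u v → inside (inj₁ u) (inj₁ v)
      ; outside = out }
      where
      open Stage s
      out : ∀ {u v} → label a u ≡ label a v → ∀ {y} → Outside a (ψ ∘ inj₁) y → adj (ψ (inj₁ u)) y ≡ adj (ψ (inj₁ v)) y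
      out {u} {v} eq {y} y∉a with hit? b (ψ ∘ inj₂) y
      ... | yes (w , refl) = trans (inside (inj₁ u) (inj₂ w))
                               (trans (cong (λ l → future l (label b w)) eq) (sym (inside (inj₁ v) (inj₂ w))))
      ... | no y∉b = outside eq λ { (inj₁ w) → y∉a w ; (inj₂ w) eq → y∉b (w , eq) }

    stage-⊕ʳ : ∀ {a b ψ} → Stage (a ⊕ b) ψ → Stage b (ψ ∘ inj₂)
    stage-⊕ʳ {a} {b} {ψ} s = record
      { future = future
      ; inside = λ u v → inside (inj₂ u) (inj₂ v)
      ; outside = out }
      where
      open Stage s
      out : ∀ {u v} → label b u ≡ label b v → ∀ {y} → Outside b (ψ ∘ inj₂) y → adj (ψ (inj₂ u)) y ≡ adj (ψ (inj₂ v)) y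
      out {u} {v} eq {y} y∉b with hit? a (ψ ∘ inj₁) y
      ... | yes (w , refl) = trans (inside (inj₂ u) (inj₁ w))
                               (trans (cong (λ l → future l (label a w)) eq) (sym (inside (inj₂ v) (inj₁ w))))
      ... | no y∉a = outside eq λ { (inj₂ w) → y∉b w ; (inj₁ w) eq → y∉a (w , eq) }

    Touched : (e : Expr k) → (⟦ e ⟧ → Position) → Fin R → Set
    Touched e ψ r = ∃ λ u → proj₂ (ψ u) ≡ r

    touched? : (e : Expr k) (ψ : ⟦ e ⟧ → Position) (r : Fin R) → Dec (Touched e ψ r)
    touched? e ψ r = search e λ u → proj₂ (ψ u) ≟ r

    Small : (e : Expr k) → (⟦ e ⟧ → Position) → Set
    Small e ψ = ∃ λ (g : Fin R → Fin q) → ∀ {r r′} → Touched e ψ r → Touched e ψ r′ → g r ≡ g r′ → r ≡ r′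

    -- Among b + 1 cells of the row, one in each spine column, two carry the same label, but a cell
    -- of the untouched row is adjacent to only one of them.
    no-full-row : ∀ {e ψ} → Stage e ψ → ∀ {r r₀} → (∀ c → ∃ λ u → ψ u ≡ (c , r)) → ¬ ¬ Touched e ψ r₀
    no-full-row {e} {ψ} s {r} {r₀} full untouched with pigeonhole (s≤s k≤b) (λ i → label e (proj₁ (full (spine i))))
    ... | i , j , i<j , eq = contradiction
      (trans (sym (spine-adj i r≢r₀)) (trans (subst₂ (λ x y → adj x (spine i , r₀) ≡ adj y (spine i , r₀)) (proj₂ (full (spine i))) (proj₂ (full (spine j)))
                 (outside eq λ u eq → untouched (u , cong proj₂ eq)))
               (spine-nonadj r r₀ (<⇒≢ i<j ∘ sym) r≢r₀)))
      λ ()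
      where
      open Stage s
      r≢r₀ : r ≢ r₀
      r≢r₀ refl = untouched (proj₁ (full (spine zero)) , cong proj₂ (proj₂ (full (spine zero))))

    -- Two of the `q` rows agree in the columns of their boundary edge and in the label of its inner
    -- end. The outer end in the first row is adjacent to the inner end there but not to the one in
    -- the second row, although the labels coincide.
    no-many-mixed-rows : ∀ {e ψ} → Stage e ψ → (f : Fin q → Fin R) → Injective _≡_ _≡_ f →
      ¬ (∀ i → ∃ λ c → ∃ λ c′ → Consecutive c c′ × (∃ λ u → ψ u ≡ (c , f i)) × ¬ ∃ λ u → ψ u ≡ (c′ , f i))
    no-many-mixed-rows {e} {ψ} s f f-inj mixed with pigeonhole (s≤s (ℕ.*-monoʳ-≤ M (ℕ.*-monoʳ-≤ M k≤b)))
      (λ i → let c , c′ , _ , (u , _) , _ = mixed i in combine c (combine c′ (label e u)))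
    ... | i , j , i<j , eq with mixed i | mixed j
    ...   | c , c′ , near , (u , u≡) , out | d , d′ , _ , (v , v≡) , _
      with combine-injective c _ d _ eq
    ...   | refl , eq′ with combine-injective c′ _ d′ _ eq′
    ...   | refl , same = contradiction
      (trans (sym (row-adj near)) (trans (subst₂ (λ x y → adj x (c′ , f i) ≡ adj y (c′ , f i)) u≡ v≡ (outside same (curry out)))
        (row-nonadj near λ fj≡fi → <⇒≢ i<j (f-inj (sym fj≡fi)))))
      λ ()
      where open Stage s

    -- At the first ⊕ touching q or more rows both operands touch fewer, so some of the R > 2q rows
    -- is still untouched.
    small : ∀ e ψ → Stage e ψ → Small e ψ
    small (• i) ψ s = (λ _ → zero) , λ (_ , eq) (_ , eq′) _ → trans (sym eq) eq′
    small (η i j i≢j e) ψ s = small e ψ (stage-η s)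
    small (ρ i j e) ψ s = small e ψ (stage-ρ s)
    small (a ⊕ b) ψ s with few-or-many (touched? (a ⊕ b) ψ) q
    ... | inj₂ few = few
    ... | inj₁ (f , f-inj , f-touched) = ⊥-elim (absurd (any? λ r → ¬? (touched? (a ⊕ b) ψ r)))
      where
      Full : Fin R → Set
      Full r = ∀ c → ∃ λ u → ψ u ≡ (c , r)
      full? : ∀ r → Dec (Full r)
      full? r = all? λ c → hit? (a ⊕ b) ψ (c , r)
      mixed : ¬ ∃ (Full ∘ f) → ∀ i → ∃ λ c → ∃ λ c′ → Consecutive c c′ × (∃ λ u → ψ u ≡ (c , f i)) × ¬ ∃ λ u → ψ u ≡ (c′ , f i)
      mixed none i = boundary (λ c → hit? (a ⊕ b) ψ (c , f i))
        (let u , eq = f-touched i in proj₁ (ψ u) , u , cong (proj₁ (ψ u) ,_) eq)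
        (¬∀⟶∃¬ M _ (λ c → hit? (a ⊕ b) ψ (c , f i)) λ full → none (i , full))
      gˡ = small a (ψ ∘ inj₁) (stage-⊕ˡ s)
      gʳ = small b (ψ ∘ inj₂) (stage-⊕ʳ s)
      absurd : Dec (∃ λ r → ¬ Touched (a ⊕ b) ψ r) → ⊥
      absurd (yes (r₀ , untouched)) with any? (full? ∘ f)
      ... | yes (i , full) = no-full-row s full untouched
      ... | no none        = no-many-mixed-rows s f f-inj (mixed none)
      absurd (no none) = <⇒notInjective {f = g} (ℕ.n<1+n (q + q)) g-inj
        where
        side : ∀ r → Touched a (ψ ∘ inj₁) r ⊎ Touched b (ψ ∘ inj₂) r
        side r with touched? (a ⊕ b) ψ r
        ... | yes (inj₁ u , eq) = inj₁ (u , eq)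
        ... | yes (inj₂ u , eq) = inj₂ (u , eq)
        ... | no untouched = contradiction (r , untouched) none
        g : Fin R → Fin (q + q)
        g r with side r
        ... | inj₁ _ = proj₁ gˡ r ↑ˡ q
        ... | inj₂ _ = q ↑ʳ proj₁ gʳ r
        g-inj : Injective _≡_ _≡_ g
        g-inj {r} {r′} eq with side r | side r′
        ... | inj₁ t | inj₁ t′ = proj₂ gˡ t t′ (↑ˡ-injective q _ _ eq)
        ... | inj₂ t | inj₂ t′ = proj₂ gʳ t t′ (↑ʳ-injective q _ _ eq)
        ... | inj₁ _ | inj₂ _ = contradiction eq ↑ˡ≢↑ʳ
        ... | inj₂ _ | inj₁ _ = contradiction (sym eq) ↑ˡ≢↑ʳ

    -- At the root no edge remains to be added and no cell is outside, so `small` applies; it would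
    -- number all `R` rows with only `q` values.
    no-expression : ∀ (e : Expr k) (ψ : ⟦ e ⟧ → Position) → (∀ y → ∃ λ u → ψ u ≡ y) →
                    ¬ (∀ u v → adj (ψ u) (ψ v) ≡ edge e u v)
    no-expression e ψ onto adj≡edge = <⇒notInjective {f = proj₁ g} (ℕ.s≤s (ℕ.m≤m+n q q))
      (proj₂ g (touched _) (touched _))
      where
      g = small e ψ record
        { future = λ _ _ → false
        ; inside = λ u v → trans (adj≡edge u v) (sym (Bool.∨-identityʳ _))
        ; outside = λ _ {y} out → contradiction (proj₂ (onto y)) (out (proj₁ (onto y))) }
      touched : ∀ r → Touched e ψ r
      touched r = let u , eq = onto (proj₁ (ψ (proj₁ (onto (spine zero , r)))) , r) in u , cong proj₂ eq

-- The infinite graph and the class of its induced subgraphs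

Cell : Set
Cell = ℕ × ℕ

-- A cell is a pair (column , row): every row is a path, and every column whose number is a
-- multiple of p is a clique.
Adjacent : ℕ → Cell → Cell → Set
Adjacent p (c , r) (c′ , r′) = (r ≡ r′ × (suc c ≡ c′ ⊎ suc c′ ≡ c)) ⊎ (r ≢ r′ × c ≡ c′ × p ∣ c)

adjacent? : ∀ p x y → Dec (Adjacent p x y)
adjacent? p (c , r) (c′ , r′) =
  ((r ℕ.≟ r′) ×-dec ((suc c ℕ.≟ c′) ⊎-dec (suc c′ ℕ.≟ c))) ⊎-dec
  (¬? (r ℕ.≟ r′) ×-dec ((c ℕ.≟ c′) ×-dec (p ∣? c)))

Adjacent-sym : ∀ {p x y} → Adjacent p x y → Adjacent p y x
Adjacent-sym (inj₁ (r≡ , near))       = inj₁ (sym r≡ , Sum.swap near)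
Adjacent-sym (inj₂ (r≢ , refl , p∣c)) = inj₂ (r≢ ∘ sym , refl , p∣c)

Adjacent-irrefl : ∀ {p x} → ¬ Adjacent p x x
Adjacent-irrefl (inj₁ (_ , inj₁ eq)) = ℕ.1+n≢n eq
Adjacent-irrefl (inj₁ (_ , inj₂ eq)) = ℕ.1+n≢n eq
Adjacent-irrefl (inj₂ (r≢r , _))     = r≢r refl

-- Adjacency sees rows only through equality, and columns only through differences and divisibility
-- by `p`. So a pattern may be moved to another window and its rows spread out, as `embeds` does.
Adjacent-shift : ∀ {p m c c′} {r r′ s s′ : ℕ} → p ∣ m → (r ≡ r′ → s ≡ s′) → (s ≡ s′ → r ≡ r′) →
                 Adjacent p (c , r) (c′ , r′) ⇔ Adjacent p (c + m , s) (c′ + m , s′)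
Adjacent-shift {p} {m} {c} {c′} p∣m to from = mk⇔
  (λ { (inj₁ (r≡ , near))        → inj₁ (to r≡ , Sum.map (cong (_+ m)) (cong (_+ m)) near)
     ; (inj₂ (r≢ , refl , p∣c)) → inj₂ (r≢ ∘ from , refl , ∣m∣n⇒∣m+n p∣c p∣m) })
  (λ { (inj₁ (s≡ , near))        → inj₁ (from s≡ , Sum.map (ℕ.+-cancelʳ-≡ m _ _) (ℕ.+-cancelʳ-≡ m _ _) near)
     ; (inj₂ (s≢ , c≡ , p∣))    → inj₂ (s≢ ∘ to , ℕ.+-cancelʳ-≡ m _ _ c≡ , ∣m+n∣m⇒∣n (subst (p ∣_) (ℕ.+-comm c m) p∣) p∣m) })

-- The host graph is infinite, hence not a `Graph`, so the class is given by embeddings into it.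
Embedding : ℕ → Graph → Set
Embedding p G = ∃ λ (f : Vertex G → Cell) →
  Injective _≡_ _≡_ f × (∀ u v → Graph.adj G u v ≡ does (adjacent? p (f u) (f v)))

embedding-hereditary : ∀ p → Hereditary (Embedding p)
embedding-hereditary p (h , h-inj , h-adj) (f , f-inj , f-adj) =
  f ∘ h , (λ eq → h-inj (f-inj eq)) , λ u v → trans (h-adj u v) (f-adj (h u) (h v))

grid : ∀ (p M R : ℕ) → ⦃ NonZero (M * R) ⦄ → Graph
grid p M R = record
  { order = M * R
  ; adj = λ u v → does (adjacent? p (cell u) (cell v))
  ; sym = λ u v → does-⇔ (mk⇔ Adjacent-sym Adjacent-sym) (adjacent? p (cell u) (cell v)) (adjacent? p (cell v) (cell u))
  ; irrefl = λ v → dec-false (adjacent? p (cell v) (cell v)) Adjacent-irrefl }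
  where
  cell : Fin (M * R) → Cell
  cell v = let c , r = remQuot {M} R v in toℕ c , toℕ r

grid-embedding : ∀ p M R ⦃ _ : NonZero (M * R) ⦄ → Embedding p (grid p M R)
grid-embedding p M R = (λ v → let c , r = remQuot {M} R v in toℕ c , toℕ r) ,
  (λ {u} {v} eq → trans (sym (combine-remQuot {M} R u)) (trans
    (cong₂ combine (toℕ-injective (cong proj₁ eq)) (toℕ-injective (cong proj₂ eq))) (combine-remQuot {M} R v))) ,
  λ _ _ → refl

-- Arithmetic of windows and of lexicographic keys

module _ {K : ℕ} ⦃ _ : NonZero K ⦄ where

  %-unique : ∀ {a} s → a < K → (a + s * K) % K ≡ a
  %-unique {a} s a<K = trans ([m+kn]%n≡m%n a s K) (m<n⇒m%n≡m a<K)

  /-unique : ∀ {a} s → a < K → (a + s * K) / K ≡ s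
  /-unique {a} s a<K = trans (+-distrib-/-∣ʳ a (divides-refl s))
                             (cong₂ _+_ (m<n⇒m/n≡0 a<K) (m*n/n≡m s K))

  suc-divMod : ∀ c → (suc c / K ≡ c / K × suc c % K ≡ suc (c % K)) ⊎
                     (suc c / K ≡ suc (c / K) × suc c % K ≡ 0 × suc (c % K) ≡ K)
  suc-divMod c with ℕ.m≤n⇒m<n∨m≡n (m%n<n c K)
  ... | inj₁ lt = inj₁ (trans (cong (_/ K) split) (/-unique (c / K) lt) , trans (cong (_% K) split) (%-unique (c / K) lt))
    where
    split : suc c ≡ suc (c % K) + c / K * K
    split = cong suc (m≡m%n+[m/n]*n c K)
  ... | inj₂ eq = inj₂ (trans (cong (_/ K) split) (/-unique (suc (c / K)) 0<K) , trans (cong (_% K) split) (%-unique (suc (c / K)) 0<K) , eq)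
    where
    split : suc c ≡ 0 + suc (c / K) * K
    split = trans (cong suc (m≡m%n+[m/n]*n c K)) (cong (_+ c / K * K) eq)
    0<K : 0 < K
    0<K = ℕ.>-nonZero⁻¹ K

lex-≤ : ∀ {B a b a′ b′} → b < B → b′ < B → a * B + b ≤ a′ * B + b′ → a < a′ ⊎ (a ≡ a′ × b ≤ b′)
lex-≤ {B} {a} {b} {a′} {b′} b< b′< le with ℕ.<-cmp a a′
... | tri< a<a′ _ _ = inj₁ a<a′
... | tri≈ _ refl _ = inj₂ (refl , ℕ.+-cancelˡ-≤ (a * B) b b′ le)
... | tri> _ _ a′<a = contradiction le (ℕ.<⇒≱ (begin-strict
  a′ * B + b′ <⟨ ℕ.+-monoʳ-< (a′ * B) b′< ⟩
  a′ * B + B  ≡⟨ ℕ.+-comm (a′ * B) B ⟩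
  suc a′ * B  ≤⟨ ℕ.*-monoˡ-≤ B a′<a ⟩
  a * B       ≤⟨ ℕ.m≤m+n (a * B) b ⟩
  a * B + b   ∎))
  where open ℕ.≤-Reasoning

-- Distances 0, 1 and 2 survive the cap at 3, which stands for "far"; so if one of the two numbers
-- is near `w`, its capped distance determines it.
capped-∸-cancel : ∀ {w a b} → a ≤ w → b ≤ w → w ≤ 2 + a → (w ∸ a) ⊓ 3 ≡ (w ∸ b) ⊓ 3 → a ≡ b
capped-∸-cancel {w} {a} {b} a≤w b≤w w≤2+a eq = ℕ.∸-cancelˡ-≡ a≤w b≤w (cancel small (ℕ.m≤n⇒m⊓n≡m (ℕ.m≤n⇒m≤1+n small)) eq)
  where
  small : w ∸ a ≤ 2
  small = ℕ.m≤n+o⇒m∸n≤o w a (ℕ.≤-trans w≤2+a (ℕ.≤-reflexive (ℕ.+-comm 2 a)))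
  cancel : ∀ {m n} → m ≤ 2 → m ⊓ 3 ≡ m → m ⊓ 3 ≡ n ⊓ 3 → m ≡ n
  cancel {m} {n} m≤2 m≡ eq with ℕ.≤-total n 3
  ... | inj₁ n≤3 = trans (sym m≡) (trans eq (ℕ.m≤n⇒m⊓n≡m n≤3))
  ... | inj₂ 3≤n = contradiction (subst (_≤ 2) (trans (sym m≡) (trans eq (ℕ.m≥n⇒m⊓n≡n 3≤n))) m≤2) (ℕ.<-irrefl refl)

flag : ∀ {P : Set} → Dec P → Fin 2
flag (yes _) = suc zero
flag (no  _) = zero

flag-transfer : ∀ {P Q : Set} {P? : Dec P} {Q? : Dec Q} → flag P? ≡ flag Q? → P → Q
flag-transfer {P? = yes _} {yes q} _ _ = q
flag-transfer {P? = no ¬p} _ p = contradiction p ¬p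

-- Upper bound: sweeping window by window

module Windows {p : ℕ} (G : Graph) (emb : Embedding p G) (K N : ℕ) ⦃ _ : NonZero K ⦄ where

  open Graph G using (adj)
  f = proj₁ emb
  f-inj = proj₁ (proj₂ emb)
  f-adj = proj₂ (proj₂ emb)

  col row win off : Vertex G → ℕ
  col = proj₁ ∘ f
  row = proj₂ ∘ f
  win u = col u / K
  off u = col u % K

  col-split : ∀ u → col u ≡ off u + win u * K
  col-split u = m≡m%n+[m/n]*n (col u) K

  cell-injective : ∀ {u v} → col u ≡ col v → row u ≡ row v → u ≡ v
  cell-injective c≡ r≡ = f-inj (cong₂ _,_ c≡ r≡)

  Present : ℕ → ℕ → ℕ → Set
  Present s i r = ∃ λ u → col u ≡ i + s * K × row u ≡ r

  present? : ∀ s i r → Dec (Present s i r)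
  present? s i r = any? λ u → (col u ℕ.≟ i + s * K) ×-dec (row u ℕ.≟ r)

  present : ∀ u → Present (win u) (off u) (row u)
  present u = u , col-split u , refl

  Full : ℕ → ℕ → Set
  Full s r = ∀ {i} → i < K → Present s i r

  full? : ∀ s r → Dec (Full s r)
  full? s r = ℕ.allUpTo? (λ i → present? s i r) K

  gap? : ∀ s i r → Dec (∃ λ j → j < i × ¬ Present s j r)
  gap? s i r = ℕ.anyUpTo? (λ j → ¬? (present? s j r)) i

  gap : ℕ → ℕ → ℕ → ℕ
  gap s i r = if does (gap? s i r) then 1 else 0

  gap≤1 : ∀ s i r → gap s i r ≤ 1
  gap≤1 s i r with does (gap? s i r)
  ... | true  = ℕ.≤-refl
  ... | false = ℕ.z≤n

  gap-zero : ∀ s r → gap s 0 r ≡ 0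
  gap-zero s r = cong (λ b → if b then 1 else 0) (dec-false (gap? s 0 r) λ ())

  gap-suc : ∀ {s i r} → Present s i r → gap s (suc i) r ≡ gap s i r
  gap-suc {s} {i} {r} at-i = cong (λ b → if b then 1 else 0) (does-⇔ (mk⇔ to from) (gap? s (suc i) r) (gap? s i r))
    where
    to : (∃ λ j → j < suc i × ¬ Present s j r) → ∃ λ j → j < i × ¬ Present s j r
    to (j , s≤s j≤i , absent) = j , ℕ.≤∧≢⇒< j≤i (λ { refl → absent at-i }) , absent
    from : (∃ λ j → j < i × ¬ Present s j r) → ∃ λ j → j < suc i × ¬ Present s j r
    from (j , j<i , absent) = j , ℕ.m<n⇒m<1+n j<i , absent

  -- A row is cut at its first absent cell in every window, so that a row edge whose ends have
  -- different stages lies in a row that is full in a window.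
  stage : Vertex G → ℕ
  stage u = win u + gap (win u) (off u) (row u)

  win≤stage : ∀ u → win u ≤ stage u
  win≤stage u = ℕ.m≤m+n _ _

  stage≤1+win : ∀ u → stage u ≤ 1 + win u
  stage≤1+win u = ℕ.≤-trans (ℕ.+-monoʳ-≤ (win u) (gap≤1 (win u) (off u) (row u))) (ℕ.≤-reflexive (ℕ.+-comm (win u) 1))

  -- Within a window the stages agree because the cell of `u` is present. At a window border `y`
  -- starts afresh with no gap, so its stage is `1 + win u`; this is the stage of `u` unless the row
  -- has no gap before `u`, the last cell of its window, and then the row is full.
  row-step : ∀ u y → suc (col u) ≡ col y → row u ≡ row y →
             win y ≤ 1 + win u × win u ≤ win y × (stage u ≡ stage y ⊎ stage u < stage y × Full (win u) (row u))
  row-step u y c≡ r≡ with suc-divMod {K} (col u)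
  ... | inj₁ (w≡ , o≡) = ℕ.≤-trans (ℕ.≤-reflexive (sym win≡)) (ℕ.n≤1+n _) , ℕ.≤-reflexive win≡ , inj₁ (begin
    win u + gap (win u) (off u) (row u)       ≡⟨ cong (win u +_) (gap-suc {win u} (present u)) ⟨
    win u + gap (win u) (suc (off u)) (row u) ≡⟨ cong₂ (λ w r → w + gap w (suc (off u)) r) win≡ r≡ ⟩
    win y + gap (win y) (suc (off u)) (row y) ≡⟨ cong (λ o → win y + gap (win y) o (row y)) off≡ ⟩
    win y + gap (win y) (off y) (row y)       ∎)
    where
    open ≡-Reasoning
    win≡ : win u ≡ win y
    win≡ = trans (sym w≡) (cong (_/ K) c≡)
    off≡ : suc (off u) ≡ off y
    off≡ = trans (sym o≡) (cong (_% K) c≡)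
  ... | inj₂ (w≡ , o≡ , last) = ℕ.≤-reflexive (sym win≡) , ℕ.≤-trans (ℕ.n≤1+n _) (ℕ.≤-reflexive win≡) , compare
    where
    win≡ : suc (win u) ≡ win y
    win≡ = trans (sym w≡) (cong (_/ K) c≡)
    off≡ : 0 ≡ off y
    off≡ = trans (sym o≡) (cong (_% K) c≡)
    stage-y : suc (win u) ≡ stage y
    stage-y = trans win≡ (trans (sym (ℕ.+-identityʳ _)) (cong (win y +_)
      (trans (sym (gap-zero (win y) (row y))) (cong (λ o → gap (win y) o (row y)) off≡))))
    compare : stage u ≡ stage y ⊎ stage u < stage y × Full (win u) (row u)
    compare with gap? (win u) (off u) (row u)
    ... | yes _  = inj₁ (trans (ℕ.+-comm (win u) 1) stage-y)
    ... | no none = inj₂ (subst (_≤ stage y) (sym (cong suc (ℕ.+-identityʳ _))) (ℕ.≤-reflexive stage-y) , full)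
      where
      full : Full (win u) (row u)
      full {i} i<K with ℕ.m≤n⇒m<n∨m≡n (ℕ.s≤s⁻¹ (subst (i <_) (sym last) i<K))
      ... | inj₂ refl = present u
      ... | inj₁ i<off = decidable-stable (present? (win u) i (row u)) λ absent → none (i , i<off , absent)

  B : ℕ
  B = proj₁ (bounded row) ⊔ proj₁ (bounded col)

  row< : ∀ u → row u < B
  row< u = ℕ.≤-trans (proj₂ (bounded row) u) (ℕ.m≤m⊔n _ _)

  col< : ∀ u → col u < B
  col< u = ℕ.≤-trans (proj₂ (bounded col) u) (ℕ.m≤n⊔m _ _)

  rowF : Vertex G → Fin B
  rowF u = fromℕ< (row< u)

  -- Three digits in base `B`: the sweep goes stage by stage, in a stage row by row, and in a row
  -- from left to right.
  key : Vertex G → ℕ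
  key u = (stage u * B + row u) * B + col u

  key-≤ : ∀ {u v} → key u ≤ key v → stage u < stage v ⊎ stage u ≡ stage v × (row u < row v ⊎ row u ≡ row v × col u ≤ col v)
  key-≤ {u} {v} le with lex-≤ {a = stage u * B + row u} {a′ = stage v * B + row v} (col< u) (col< v) le
  ... | inj₁ lt with lex-≤ {a = stage u} {a′ = stage v} (row< u) (row< v) (ℕ.<⇒≤ lt)
  ...   | inj₁ s< = inj₁ s<
  ...   | inj₂ (s≡ , _) = inj₂ (s≡ , inj₁ (ℕ.+-cancelˡ-< (stage v * B) _ _ (subst (λ s → s * B + row u < stage v * B + row v) s≡ lt)))
  key-≤ {u} {v} le | inj₂ (eq , c≤) with lex-≤ {a = stage u} {a′ = stage v} (row< u) (row< v) (ℕ.≤-reflexive eq)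
  ... | inj₁ s< = inj₁ s<
  ... | inj₂ (s≡ , _) = inj₂ (s≡ , inj₂ (ℕ.+-cancelˡ-≡ (stage v * B) _ _ (subst (λ s → s * B + row u ≡ stage v * B + row v) s≡ eq) , c≤))

  key-stage : ∀ {u v} → key u ≤ key v → stage u ≤ stage v
  key-stage le with key-≤ le
  ... | inj₁ s<       = ℕ.<⇒≤ s<
  ... | inj₂ (s≡ , _) = ℕ.≤-reflexive s≡

  key-row : ∀ {u v} → key u ≤ key v → stage u ≡ stage v → row u ≤ row v
  key-row le s≡ with key-≤ le
  ... | inj₁ s<                   = contradiction s≡ (ℕ.<⇒≢ s<)
  ... | inj₂ (_ , inj₁ r<)        = ℕ.<⇒≤ r<
  ... | inj₂ (_ , inj₂ (r≡ , _)) = ℕ.≤-reflexive r≡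

  key-col : ∀ {u v} → key u ≤ key v → stage u ≡ stage v → row u ≡ row v → col u ≤ col v
  key-col le s≡ r≡ with key-≤ le
  ... | inj₁ s<                   = contradiction s≡ (ℕ.<⇒≢ s<)
  ... | inj₂ (_ , inj₁ r<)        = contradiction r≡ (ℕ.<⇒≢ r<)
  ... | inj₂ (_ , inj₂ (_ , c≤)) = c≤

  key-injective : Injective _≡_ _≡_ key
  key-injective {u} {v} eq = cell-injective (ℕ.≤-antisym (key-col u≤v s≡ r≡) (key-col v≤u (sym s≡) (sym r≡))) r≡
    where
    u≤v = ℕ.≤-reflexive eq
    v≤u = ℕ.≤-reflexive (sym eq)
    s≡ : stage u ≡ stage v
    s≡ = ℕ.≤-antisym (key-stage {u} {v} u≤v) (key-stage {v} {u} v≤u)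
    r≡ : row u ≡ row v
    r≡ = ℕ.≤-antisym (key-row {u} {v} u≤v s≡) (key-row {v} {u} v≤u (sym s≡))

  ManyFull : Set
  ManyFull = ∃ λ s → ∃ λ (ι : Fin N → Fin B) → Injective _≡_ _≡_ ι × ∀ i → Full s (toℕ (ι i))

  module Few (few : ¬ ManyFull) where

    rank-full : ∀ s → ∃ λ (g : Fin B → Fin N) → ∀ {r r′} → Full s (toℕ r) → Full s (toℕ r′) → g r ≡ g r′ → r ≡ r′
    rank-full s with few-or-many (λ r → full? s (toℕ r)) N
    ... | inj₁ many = contradiction (s , many) few
    ... | inj₂ rank = rank

    rank : ℕ → Fin B → Fin N
    rank s = proj₁ (rank-full s)

    size : ℕ
    size = 4 * (K * (N * (2 * 2)))

    distance : Vertex G → Vertex G → Fin 4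
    distance x u = fromℕ< {(stage x ∸ win u) ⊓ 3} (s≤s (ℕ.m⊓n≤n _ 3))

    -- Distance and offset recover the column of `u` when its window is near. The rank recovers the
    -- row when the first flag says that it is full, and the second flag recognises the row being
    -- swept.
    class : Vertex G → Vertex G → Fin size
    class x u = combine (distance x u)
                 (combine (fromℕ< (m%n<n (col u) K))
                 (combine (rank (win u) (rowF u))
                 (combine (flag (full? (win u) (row u))) (flag (row u ℕ.≟ row x)))))

    module SameClass {x u v : Vertex G} (u≤x : key u ≤ key x) (v≤x : key v ≤ key x) (eq : class x u ≡ class x v) where

      eq₁ = combine-injective (distance x u) _ (distance x v) _ eq
      eq₂ = combine-injective (fromℕ< (m%n<n (col u) K)) _ (fromℕ< (m%n<n (col v) K)) _ (proj₂ eq₁)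
      eq₃ = combine-injective (rank (win u) (rowF u)) _ (rank (win v) (rowF v)) _ (proj₂ eq₂)
      eq₄ = combine-injective (flag (full? (win u) (row u))) _ (flag (full? (win v) (row v))) _ (proj₂ eq₃)

      distance≡ : (stage x ∸ win u) ⊓ 3 ≡ (stage x ∸ win v) ⊓ 3
      distance≡ = fromℕ<-injective _ _ _ _ (proj₁ eq₁)

      off≡ : off u ≡ off v
      off≡ = fromℕ<-injective _ _ _ _ (proj₁ eq₂)

      win≤ : ∀ {z} → key z ≤ key x → win z ≤ stage x
      win≤ {z} le = ℕ.≤-trans (win≤stage z) (key-stage {z} {x} le)

      win≡ : stage x ≤ 2 + win u → win u ≡ win v
      win≡ near = capped-∸-cancel (win≤ u≤x) (win≤ v≤x) near distance≡

      col≡ : win u ≡ win v → col u ≡ col v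
      col≡ w≡ = trans (col-split u) (trans (cong₂ (λ o w → o + w * K) off≡ w≡) (sym (col-split v)))

      row≡-full : win u ≡ win v → Full (win u) (row u) → row u ≡ row v
      row≡-full w≡ full = fromℕ<-injective _ _ (row< u) (row< v) (proj₂ (rank-full (win u))
        (subst (Full (win u)) (sym (toℕ-fromℕ< (row< u))) full)
        (subst₂ Full (sym w≡) (sym (toℕ-fromℕ< (row< v))) (flag-transfer (proj₁ eq₄) full))
        (trans (proj₁ eq₃) (cong (λ w → rank w (rowF v)) (sym w≡))))

      row≡-current : row u ≡ row x → row u ≡ row v
      row≡-current r≡ = trans r≡ (sym (flag-transfer (proj₂ eq₄) r≡))

      -- A clique edge to a later `y` depends only on the column, which the class recovers. For a
      -- row edge the class recovers the row as well, so `u` and `v` are the same vertex.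
      transfer : ∀ {y} → key x < key y → Adjacent p (f u) (f y) → Adjacent p (f v) (f y)
      transfer {y} x<y (inj₂ (r≢ , c≡ , p∣c)) = inj₂
        -- In the row of `y`, the vertex `v` would be `y` itself, which comes after `x`.
        ( (λ r≡ → ℕ.<⇒≱ x<y (subst (λ z → key z ≤ key x) (cell-injective (trans (sym c≡v) c≡) r≡) v≤x))
        , trans (sym c≡v) c≡ , subst (p ∣_) c≡v p∣c )
        where
        near : stage x ≤ 2 + win u
        near = ℕ.≤-trans (key-stage {x} {y} (ℕ.<⇒≤ x<y)) (ℕ.≤-trans (stage≤1+win y)
          (ℕ.≤-trans (ℕ.≤-reflexive (cong (λ c → suc (c / K)) (sym c≡))) (ℕ.n≤1+n _)))
        c≡v : col u ≡ col v
        c≡v = col≡ (win≡ near)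
      transfer {y} x<y a@(inj₁ (r≡ , near)) = subst (λ z → Adjacent p (f z) (f y)) u≡v a
        where
        x≤y = ℕ.<⇒≤ x<y
        -- Either the edge stays within one stage or its row is full in the window of the left end.
        -- In the latter case the left end has the smaller stage, so it is `u` and not the later
        -- `y`.
        close : suc (col u) ≡ col y ⊎ suc (col y) ≡ col u → win y ≤ 1 + win u × (stage u ≡ stage y ⊎ Full (win u) (row u))
        close (inj₁ c≡) = let w , _ , o = row-step u y c≡ r≡ in w , Sum.map id proj₂ o
        close (inj₂ c≡) with row-step y u c≡ (sym r≡)
        ... | _ , w , inj₁ s≡ = ℕ.m≤n⇒m≤1+n w , inj₁ (sym s≡)
        ... | _ , _ , inj₂ (s< , _) = contradiction s< (ℕ.≤⇒≯ (ℕ.≤-trans (key-stage {u} {x} u≤x) (key-stage {x} {y} x≤y)))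
        w≡ : win u ≡ win v
        w≡ = win≡ (ℕ.≤-trans (key-stage {x} {y} x≤y) (ℕ.≤-trans (stage≤1+win y) (s≤s (proj₁ (close near)))))
        -- The sweep meets `x` between `u` and `y`, so a common stage and row of these two are also
        -- those of `x`.
        current : stage u ≡ stage y → row u ≡ row x
        current s≡ = ℕ.≤-antisym (key-row {u} {x} u≤x s≡x)
                                 (ℕ.≤-trans (key-row {x} {y} x≤y (trans (sym s≡x) s≡)) (ℕ.≤-reflexive (sym r≡)))
          where
          s≡x : stage u ≡ stage x
          s≡x = ℕ.≤-antisym (key-stage {u} {x} u≤x) (ℕ.≤-trans (key-stage {x} {y} x≤y) (ℕ.≤-reflexive (sym s≡)))
        u≡v : u ≡ v
        u≡v = cell-injective (col≡ w≡) ([ row≡-current ∘ current , row≡-full w≡ ] (proj₂ (close near)))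

    constructs : ConstructsLinearly (suc size + suc size) G
    constructs = Sweep.constructs G key key-injective class λ x {u} {v} u≤x v≤x eq y x<y →
      trans (f-adj u y) (trans (does-⇔ (mk⇔ (SameClass.transfer {x} {u} {v} u≤x v≤x eq x<y)
                                            (SameClass.transfer {x} {v} {u} v≤x u≤x (sym eq) x<y))
                                       (adjacent? p (f u) (f y)) (adjacent? p (f v) (f y)))
        (sym (f-adj v y)))

  -- Window `s` begins at a multiple of `p`, and its `N` full rows offer every cell that a copy of
  -- `H` can ask for.
  embeds : ManyFull → p ∣ K → ∀ {H} (embᴴ : Embedding p H) →
           (∀ v → proj₁ (proj₁ embᴴ v) < K) → (∀ v → proj₂ (proj₁ embᴴ v) < N) → H ≼ G
  embeds (s , ι , ι-inj , full) p∣K {H} (h , h-inj , h-adj) c< r< = g , g-inj , g-adj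
    where
    rowᴴ : Vertex H → Fin N
    rowᴴ v = fromℕ< (r< v)
    place : ∀ v → Present s (proj₁ (h v)) (toℕ (ι (rowᴴ v)))
    place v = full (rowᴴ v) (c< v)
    g : Vertex H → Vertex G
    g v = proj₁ (place v)
    fg : ∀ v → f (g v) ≡ (proj₁ (h v) + s * K , toℕ (ι (rowᴴ v)))
    fg v = cong₂ _,_ (proj₁ (proj₂ (place v))) (proj₂ (proj₂ (place v)))
    row-to : ∀ {u v} → proj₂ (h u) ≡ proj₂ (h v) → toℕ (ι (rowᴴ u)) ≡ toℕ (ι (rowᴴ v))
    row-to eq = cong (toℕ ∘ ι) (toℕ-injective (trans (toℕ-fromℕ< _) (trans eq (sym (toℕ-fromℕ< _)))))
    row-from : ∀ {u v} → toℕ (ι (rowᴴ u)) ≡ toℕ (ι (rowᴴ v)) → proj₂ (h u) ≡ proj₂ (h v)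
    row-from {u} {v} eq = fromℕ<-injective _ _ (r< u) (r< v) (ι-inj (toℕ-injective eq))
    g-inj : Injective _≡_ _≡_ g
    g-inj {u} {v} eq = h-inj (cong₂ _,_ (ℕ.+-cancelʳ-≡ (s * K) _ _ (cong proj₁ cells≡)) (row-from {u} {v} (cong proj₂ cells≡)))
      where cells≡ = trans (sym (fg u)) (trans (cong f eq) (fg v))
    g-adj : ∀ u v → Graph.adj H u v ≡ adj (g u) (g v)
    g-adj u v = trans (h-adj u v) (trans
      (does-⇔ (Adjacent-shift (∣-trans p∣K (n∣m*n s)) (row-to {u} {v}) (row-from {u} {v}))
        (adjacent? p (h u) (h v)) (adjacent? p _ _))
      (trans (cong₂ (λ a b → does (adjacent? p a b)) (sym (fg u)) (sym (fg v))) (sym (f-adj (g u) (g v)))))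

-- Distinctness of the classes

not-pairwise-consecutive : ∀ {a b c : ℕ} → suc a ≡ b ⊎ suc b ≡ a → suc b ≡ c ⊎ suc c ≡ b → ¬ (suc a ≡ c ⊎ suc c ≡ a)
not-pairwise-consecutive (inj₁ refl) (inj₁ refl) (inj₁ eq) = ℕ.1+n≢n (sym eq)
not-pairwise-consecutive (inj₁ refl) (inj₁ refl) (inj₂ eq) = ℕ.m≢1+n+m _ {2} (sym eq)
not-pairwise-consecutive (inj₁ refl) (inj₂ refl) (inj₁ eq) = ℕ.1+n≢n eq
not-pairwise-consecutive (inj₁ refl) (inj₂ refl) (inj₂ eq) = ℕ.1+n≢n eq
not-pairwise-consecutive (inj₂ refl) (inj₁ refl) (inj₁ eq) = ℕ.1+n≢n eq
not-pairwise-consecutive (inj₂ refl) (inj₁ refl) (inj₂ eq) = ℕ.1+n≢n eq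
not-pairwise-consecutive (inj₂ refl) (inj₂ refl) (inj₁ eq) = ℕ.m≢1+n+m _ {2} (sym eq)
not-pairwise-consecutive (inj₂ refl) (inj₂ refl) (inj₂ eq) = ℕ.1+n≢n (sym eq)

-- Were `x` and `y` joined along a row, the triangle would consist of three row edges, impossible in
-- a path, or the other two edges would contradict the equal rows or the different columns of `x`
-- and `y`.
triangle-column : ∀ {p x y z} → Adjacent p x y → Adjacent p y z → Adjacent p x z →
                  proj₁ x ≡ proj₁ y × p ∣ proj₁ x
triangle-column (inj₂ (_ , c≡ , p∣c)) _ _ = c≡ , p∣c
triangle-column (inj₁ (_ , xy)) (inj₁ (_ , yz)) (inj₁ (_ , xz)) = contradiction xz (not-pairwise-consecutive xy yz)
triangle-column (inj₁ (r≡ , _)) (inj₂ (r≢ , _)) (inj₁ (r≡′ , _)) = contradiction (trans (sym r≡) r≡′) r≢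
triangle-column (inj₁ (r≡ , _)) (inj₁ (r≡′ , _)) (inj₂ (r≢ , _)) = contradiction (trans r≡ r≡′) r≢
triangle-column (inj₁ (_ , inj₁ eq)) (inj₂ (_ , refl , _)) (inj₂ (_ , refl , _)) = contradiction eq ℕ.1+n≢n
triangle-column (inj₁ (_ , inj₂ eq)) (inj₂ (_ , refl , _)) (inj₂ (_ , refl , _)) = contradiction eq ℕ.1+n≢n

Adjacent-column : ∀ {p x y} → Adjacent p x y → proj₁ x ≤ suc (proj₁ y)
Adjacent-column (inj₁ (_ , inj₁ refl))  = ℕ.m≤n⇒m≤1+n (ℕ.n≤1+n _)
Adjacent-column (inj₁ (_ , inj₂ refl))  = ℕ.≤-refl
Adjacent-column (inj₂ (_ , refl , _)) = ℕ.n≤1+n _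

-- The difference is a multiple of `q` smaller than `q`.
close-multiples : ∀ {p q a b} → p < q → q ∣ a → q ∣ b → a ≤ b → b ≤ a + p → a ≡ b
close-multiples {p} {q} {a} {b} p<q q∣a q∣b a≤b b≤a+p with b ∸ a in diff
... | zero  = ℕ.≤-antisym a≤b (ℕ.m∸n≡0⇒m≤n diff)
... | suc d = contradiction (∣⇒≤ (subst (q ∣_) diff (∣m+n∣m⇒∣n (subst (q ∣_) (sym (ℕ.m+[n∸m]≡n a≤b)) q∣b) q∣a)))
  (ℕ.<⇒≱ (ℕ.≤-<-trans (subst (_≤ p) diff (ℕ.m≤n+o⇒m∸n≤o b a b≤a+p)) p<q))

-- Triangles must go to clique columns, and the clique columns 0 and p of the grid are joined by a
-- path too short to reach another clique column.
module _ {p q : ℕ} ⦃ _ : NonZero p ⦄ (p<q : p < q) (emb : Embedding q (grid p (suc p) 3)) where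

  private
    image : Fin (suc p) → Fin 3 → Cell
    image c r = proj₁ emb (combine c r)

    image-adj : ∀ {c c′ r r′} → does (adjacent? p (toℕ c , toℕ r) (toℕ c′ , toℕ r′)) ≡
                does (adjacent? q (image c r) (image c′ r′))
    image-adj {c} {c′} {r} {r′} = trans (sym (cong₂ (λ x y → does (adjacent? p (toℕ (proj₁ x) , toℕ (proj₂ x)) (toℕ (proj₁ y) , toℕ (proj₂ y))))
      (remQuot-combine c r) (remQuot-combine c′ r′))) (proj₂ (proj₂ emb) (combine c r) (combine c′ r′))

    to : ∀ {c c′ r r′} → Adjacent p (toℕ c , toℕ r) (toℕ c′ , toℕ r′) → Adjacent q (image c r) (image c′ r′)
    to {c} {c′} {r} {r′} a with adjacent? q (image c r) (image c′ r′) in eq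
    ... | yes a′ = a′
    ... | no ¬a′ = contradiction (trans (sym (dec-true (adjacent? p _ _) a)) (trans (image-adj {c} {c′} {r} {r′}) (cong does eq))) λ ()

    from : ∀ {c c′ r r′} → Adjacent q (image c r) (image c′ r′) → Adjacent p (toℕ c , toℕ r) (toℕ c′ , toℕ r′)
    from {c} {c′} {r} {r′} a with adjacent? p (toℕ c , toℕ r) (toℕ c′ , toℕ r′) in eq
    ... | yes a′ = a′
    ... | no ¬a′ = contradiction (trans (sym (dec-true (adjacent? q _ _) a)) (trans (sym (image-adj {c} {c′} {r} {r′})) (cong does eq))) λ ()

    clique : ∀ {c} → p ∣ toℕ c → proj₁ (image c zero) ≡ proj₁ (image c (suc zero)) × q ∣ proj₁ (image c zero)
    clique {c} p∣c = triangle-column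
      (to {c} {c} {zero} {suc zero} (inj₂ ((λ ()) , refl , p∣c)))
      (to {c} {c} {suc zero} {suc (suc zero)} (inj₂ ((λ ()) , refl , p∣c)))
      (to {c} {c} {zero} {suc (suc zero)} (inj₂ ((λ ()) , refl , p∣c)))

    path : ∀ c (c< : c < suc p) → let x = proj₁ (image zero zero) ; y = proj₁ (image (fromℕ< c<) zero) in
           x ≤ y + c × y ≤ x + c
    path zero    (s≤s _) = ℕ.≤-reflexive (sym (ℕ.+-identityʳ _)) , ℕ.≤-reflexive (sym (ℕ.+-identityʳ _))
    path (suc c) c< = let l , r = path c (ℕ.<⇒≤ c<) in
      ℕ.≤-trans l (ℕ.≤-trans (ℕ.+-monoˡ-≤ c (Adjacent-column step)) (ℕ.≤-reflexive (sym (ℕ.+-suc _ c)))) ,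
      ℕ.≤-trans (Adjacent-column (Adjacent-sym step)) (ℕ.≤-trans (s≤s r) (ℕ.≤-reflexive (sym (ℕ.+-suc _ c))))
      where
      step : Adjacent q (image (fromℕ< (ℕ.<⇒≤ c<)) zero) (image (fromℕ< c<) zero)
      step = to (inj₁ (refl , inj₁ (trans (cong suc (toℕ-fromℕ< _)) (sym (toℕ-fromℕ< c<)))))

    end : Fin (suc p)
    end = fromℕ< (ℕ.n<1+n p)

    end≡p : toℕ end ≡ p
    end≡p = toℕ-fromℕ< (ℕ.n<1+n p)

    clique₀ = clique {zero} (p ∣0)
    cliqueₚ = clique {end} (subst (p ∣_) (sym end≡p) ∣-refl)

    same-column : proj₁ (image zero zero) ≡ proj₁ (image end zero)
    same-column with ℕ.≤-total (proj₁ (image zero zero)) (proj₁ (image end zero)) | path p (ℕ.n<1+n p)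
    ... | inj₁ le | _ , r = close-multiples p<q (proj₂ clique₀) (proj₂ cliqueₚ) le r
    ... | inj₂ ge | l , _ = sym (close-multiples p<q (proj₂ cliqueₚ) (proj₂ clique₀) ge l)

  -- The cells in column 0, row 0 and in column `p`, row 1 are distinct and not adjacent, but their
  -- images share a clique column and therefore coincide or are adjacent.
  grid-not-embeddable : ⊥
  grid-not-embeddable with proj₂ (image zero zero) ℕ.≟ proj₂ (image end (suc zero))
  ... | yes r≡ with combine-injective zero zero end (suc zero)
        (proj₁ (proj₂ emb) (cong₂ _,_ (trans same-column (proj₁ cliqueₚ)) r≡))
  ...   | _ , ()
  grid-not-embeddable | no r≢ with from {zero} {end} {zero} {suc zero} (inj₂ (r≢ , trans same-column (proj₁ cliqueₚ) , proj₂ clique₀))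
  ...   | inj₁ (() , _)
  ...   | inj₂ (_ , 0≡ , _) = ℕ.≢-nonZero⁻¹ p (sym (trans 0≡ end≡p))

-- Unboundedness and minimality for both parameters

-- A least value need not exist constructively when `P` is undecidable. The double negation
-- suffices, since unboundedness is itself a negation.
¬¬-minimum : ∀ {P : Pred ℕ 0ℓ} {n} → P n → ¬ ¬ ∃ (IsMinimum P)
¬¬-minimum {P} {n} Pn none = <-rec (λ n → ¬ P n) step n Pn
  where
  step : ∀ n → (∀ {m} → m < n → ¬ P m) → ¬ P n
  step n smaller Pn = none (n , Pn , λ k Pk → ℕ.≮⇒≥ λ k<n → smaller k<n Pk)

-- Every vertex forms a class of its own.
constructible : ∀ G → ∃ λ k → ConstructsLinearly k G
constructible G = _ , Sweep.constructs G toℕ toℕ-injective (λ _ v → v)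
  λ { x _ _ refl _ _ → refl }

module _ (p : ℕ) ⦃ _ : NonZero p ⦄ (b : ℕ) where

  -- The columns 0 to `b * p` include `b + 1` multiples of `p`, one more than the labels allowed.
  open Grid {b * p} {b}

  unbounded-grid : Graph
  unbounded-grid = grid p M R

  unbounded-grid-embedding : Embedding p unbounded-grid
  unbounded-grid-embedding = grid-embedding p M R

  ¬constructs-grid : ∀ {k} → k ≤ b → ¬ ∃ λ (e : Expr k) → e Constructs unbounded-grid
  ¬constructs-grid k≤b (e , φ , adj≡edge) = LowerBound.no-expression k≤b
    (λ x y → does (adjacent? p (cell x) (cell y)))
    (λ {c} {c′} {r} near → dec-true (adjacent? p (cell (c , r)) (cell (c′ , r))) (inj₁ (refl , near)))
    (λ near r≢ → dec-false (adjacent? p _ _) λ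
      { (inj₁ (r≡ , _)) → r≢ (toℕ-injective r≡) ; (inj₂ (_ , c≡ , _)) → consecutive⇒≢ near c≡ })
    spine
    (λ i r≢ → dec-true (adjacent? p _ _) (inj₂ (r≢ ∘ toℕ-injective , refl , subst (p ∣_) (sym (toℕ-spine i)) (n∣m*n (toℕ i)))))
    (λ {i} {j} r r′ i≢j r≢ → dec-false (adjacent? p _ _) λ
      { (inj₁ (r≡ , _)) → r≢ (toℕ-injective r≡)
      ; (inj₂ (_ , c≡ , _)) → i≢j (toℕ-injective (ℕ.*-cancelʳ-≡ _ _ p (trans (sym (toℕ-spine i)) (trans c≡ (toℕ-spine j))))) })
    e (λ a → remQuot R (from a))
    (λ (c , r) → to (combine c r) , trans (cong (remQuot R) (strictlyInverseʳ (combine c r))) (remQuot-combine c r))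
    (λ u v → trans (adj≡edge (from u) (from v)) (cong₂ (edge e) (strictlyInverseˡ u) (strictlyInverseˡ v)))
    where
    open Inverse φ
    cell : Position → Cell
    cell (c , r) = toℕ c , toℕ r
    spine< : ∀ (i : Fin (suc b)) → toℕ i * p < M
    spine< i = s≤s (ℕ.*-monoˡ-≤ p (ℕ.s≤s⁻¹ (toℕ<n i)))
    spine : Fin (suc b) → Fin M
    spine i = fromℕ< (spine< i)
    toℕ-spine : ∀ i → toℕ (spine i) ≡ toℕ i * p
    toℕ-spine i = toℕ-fromℕ< (spine< i)
    consecutive⇒≢ : ∀ {c c′ : Fin M} → Consecutive c c′ → toℕ c ≢ toℕ c′
    consecutive⇒≢ (inj₁ eq) c≡ = ℕ.1+n≢n (trans eq (sym c≡))
    consecutive⇒≢ (inj₂ eq) c≡ = ℕ.1+n≢n (trans eq c≡)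

-- Both parameters are minima of predicates lying between linear constructibility and
-- constructibility.
module _ {Q : Graph → Pred ℕ 0ℓ}
  (from-linear : ∀ {G k} → ConstructsLinearly k G → Q G k)
  (to-expression : ∀ {G k} → Q G k → ∃ λ (e : Expr k) → e Constructs G)
  (p : ℕ) ⦃ p≢0 : NonZero p ⦄ where

  embedding-unbounded : Unbounded (λ G → IsMinimum (Q G)) (Embedding p)
  embedding-unbounded (b , bound) = ¬¬-minimum {Q G} (from-linear {G} (proj₂ (constructible G))) λ (w , min) →
    ¬constructs-grid p b (bound G (unbounded-grid-embedding p b) w min) (to-expression {G} (proj₁ min))
    where
    G = unbounded-grid p b

  -- A member of `Y` with `N` full rows in one window would contain `H` and so put it into `Y`.
  -- Hence every member has few full rows, and the resulting number of labels depends only on `p`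
  -- and the embedding of `H`.
  subclass-bounded : ∀ Y → Hereditary Y → Y ⊊ Embedding p → Bounded (λ G → IsMinimum (Q G)) Y
  subclass-bounded Y hereditary (Y⊆X , H , (embᴴ@(h , _) , H∉Y)) = _ , λ G G∈Y w min →
    proj₂ min _ (from-linear {G} (Windows.Few.constructs {p} G (Y⊆X G∈Y) K N λ many →
      H∉Y (hereditary (Windows.embeds {p} G (Y⊆X G∈Y) K N many (m∣m*n (suc b)) {H} embᴴ col< row<) G∈Y)))
    where
    b = proj₁ (bounded (proj₁ ∘ h))
    N = proj₁ (bounded (proj₂ ∘ h))
    K = p * suc b
    instance
      K≢0 : NonZero K
      K≢0 = ℕ.m*n≢0 p (suc b)
    col< : ∀ v → proj₁ (h v) < K
    col< v = ℕ.≤-trans (proj₂ (bounded (proj₁ ∘ h)) v) (ℕ.≤-trans (ℕ.n≤1+n b) (ℕ.m≤n*m (suc b) p))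
    row< : ∀ v → proj₂ (h v) < N
    row< = proj₂ (bounded (proj₂ ∘ h))

  embedding-minimal : MinimalHereditaryUnbounded (λ G → IsMinimum (Q G)) (Embedding p)
  embedding-minimal = (λ {G} {H} → embedding-hereditary p {G} {H}) , embedding-unbounded , subclass-bounded

embeddings-distinct : ∀ {p q} ⦃ _ : NonZero p ⦄ → p < q → ¬ (Embedding p ⊆ Embedding q)
embeddings-distinct {p} p<q sub = grid-not-embeddable p<q (sub {grid p (suc p) 3} (grid-embedding p (suc p) 3))

theorem2 : ∃ λ (X : ℕ → Pred Graph 0ℓ) →
    (∀ i j → i ≢ j → ¬ (X i ≐ X j)) ×
    (∀ i → MinimalHereditaryUnbounded cwd (X i) ×
           MinimalHereditaryUnbounded lcwd (X i))
-- The shift by one keeps the distance between clique columns positive.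
theorem2 = (λ i → Embedding (suc i)) , distinct , λ i →
  embedding-minimal (λ (e , _ , constructs) → e , constructs) id (suc i) ,
  embedding-minimal id (λ (e , _ , constructs) → e , constructs) (suc i)
  where
  distinct : ∀ i j → i ≢ j → ¬ (Embedding (suc i) ≐ Embedding (suc j))
  distinct i j i≢j (i⊆j , j⊆i) with ℕ.<-cmp i j
  ... | tri< i<j _ _ = embeddings-distinct (s≤s i<j) λ {G} → i⊆j {G}
  ... | tri≈ _ i≡j _ = i≢j i≡j
  ... | tri> _ _ j<i = embeddings-distinct (s≤s j<i) λ {G} → j⊆i {G}
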